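{- The $(9,5)$-sequence $12,6,6,6,6$ is not a G-sequence, but every $(10,5)$-sequence is a G-sequence. Consequently $g(5)=10$.
   Context: A Gallai coloring (G-coloring) of the complete graph $K_n$ is an edge coloring of $K_n$ containing no triangle whose three edges receive three different colors. For integers $n\ge 1$, $k\ge 2$, an $(n,k)$-sequence is a sequence $e_1,\dots,e_k$ of nonnegative integers with $\sum_{i=1}^k e_i=\binom{n}{2}$; it is a G-sequence if there is a G-coloring of $K_n$ with colors $1,\dots,k$ in which exactly $e_i$ edges have color $i$ for every $i$. For every integer $k\ge 2$, $g(k)$ denotes the (unique) integer such that every $(n,k)$-sequence is a G-sequence if and only if $n\ge g(k)$.
   Formalization: The equality g(5)=10 is stated as: for all n ≥ 3, every (n,5)-sequence is a G-sequence if and only if n ≥ 10; the cases n = 1, 2 are excluded because there every sequence is trivially a G-sequence, so the definition of g(5) fails literally. -}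

module Defs where

open import Data.Nat using (ℕ; _+_; _<?_)
open import Data.Nat.Combinatorics using (_C_)
open import Data.Fin using (Fin; toℕ; zero; suc)
open import Data.Fin.Properties using (_≟_)
open import Data.List using (List; map; allFin; concatMap)
open import Data.Nat.ListAction using (sum)
open import Data.Product using (Σ; _×_)
open import Data.Vec.Functional using (Vector)
open import Relation.Nullary using (¬_; Dec; yes; no)
open import Relation.Nullary.Decidable using (⌊_⌋)
open import Relation.Binary.PropositionalEquality using (_≡_; _≢_)
open import Data.Bool using (Bool; true; false; _∧_; if_then_else_)

-- An edge colouring of K_n with colours Fin k: a symmetric function on
-- vertex pairs (its values on the diagonal are irrelevant: loops are not edges).
record EdgeColouring (n k : ℕ) : Set where
  field
    col : Fin n → Fin n → Fin k
    sym : ∀ i j → col i j ≡ col j i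
open EdgeColouring public

IsGallai : ∀ {n k} → EdgeColouring n k → Set
IsGallai {n} c = ∀ (x y z : Fin n) → x ≢ y → y ≢ z → x ≢ z →
  ¬ (col c x y ≢ col c y z × col c y z ≢ col c x z × col c x y ≢ col c x z)

colourCount : ∀ {n k} → EdgeColouring n k → Fin k → ℕ
colourCount {n} c a =
  sum (concatMap (λ i → map (λ j →
        if ⌊ toℕ i <? toℕ j ⌋ ∧ ⌊ col c i j ≟ a ⌋ then 1 else 0)
      (allFin n)) (allFin n))

seqSum : ∀ {k} → Vector ℕ k → ℕ
seqSum {k} e = sum (map e (allFin k))

IsSeq : (n k : ℕ) → Vector ℕ k → Set
IsSeq n k e = seqSum e ≡ n C 2

IsGSeq : (n k : ℕ) → Vector ℕ k → Set
IsGSeq n k e = Σ (EdgeColouring n k) λ c → IsGallai c × (∀ a → colourCount c a ≡ e a)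

AllGSeq : (n k : ℕ) → Set
AllGSeq n k = ∀ (e : Vector ℕ k) → IsSeq n k e → IsGSeq n k e

seq12-6 : Vector ℕ 5
seq12-6 zero = 12
seq12-6 (suc _) = 6

{-# OPTIONS --safe #-}
-- Call a colour class disconnected if some bipartition of the vertices is crossed
-- by no edge of the class. In a Gallai colouring the union of disconnected classes
-- is disconnected, so some colour spans K_n and has at least n − 1 edges. This
-- refutes the sequences used for 3 ≤ n ≤ 8. For 12,6,6,6,6 on K_9 the four small
-- classes are disconnected, so the first colour contains a complete bipartite
-- graph on all nine vertices; with 12 edges this must be a star, and deleting its
-- centre leaves 4,6,6,6,6 on K_8, where no colour can span.
--
-- Conversely, joining two Gallai colourings by edges of a single colour gives a
-- Gallai colouring, and every nonincreasing (10,5)-sequence comes from single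
-- vertices by such joins, which is verified by computation. For n ≥ 9 the largest
-- entry of an (n+1,5)-sequence is at least n, so a monochromatic star can be split
-- off.
module Submission where

open import Defs
open import Data.Nat using (ℕ; _≤_)
open import Data.Product using (_×_)
open import Function.Bundles using (_⇔_)
open import Relation.Nullary using (¬_)

open import Data.Bool using (Bool; true; false; _∧_; _xor_; if_then_else_)
import Data.Bool.Properties as Bool
open import Data.Bool.Properties using (T?; T-∧)
open import Data.Fin as Fin using (Fin; zero; suc; toℕ; punchIn; punchOut; pinch; splitAt; _↑ˡ_; _↑ʳ_)
open import Data.Fin.Permutation as Perm using (Permutation′; _⟨$⟩ʳ_; _⟨$⟩ˡ_)
import Data.Fin.Properties as Fin
open import Data.Fin.Properties using (_≟_; all?; any?)
open import Data.Fin.Subset using (Subset)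
open import Data.Fin.Subset.Properties using (anySubset?)
open import Data.List as List using (List; []; _∷_; _++_; allFin; cartesianProduct; concatMap; filter; length; map; upTo)
open import Data.List.Extrema.Nat using (argmax; f[xs]≤f[argmax])
import Data.List.Membership.DecPropositional as DecMembership
open import Data.List.Membership.Propositional using (_∈_)
open import Data.List.Membership.Propositional.Properties using (∈-allFin; ∈-cartesianProduct⁺; ∈-concatMap⁺; ∈-filter⁺; ∈-map⁺; ∈-map⁻; ∈-upTo⁺)
open import Data.List.Properties using (map-++; map-∘; map-tabulate)
open import Data.List.Relation.Unary.All as All using (All; []; _∷_)
open import Data.List.Relation.Unary.Any as Any using (here; there)
open import Data.Maybe as Maybe using (Maybe; just; nothing; _<∣>_)
import Data.Maybe.Relation.Unary.Any as MAny
open import Data.Nat using (zero; suc; _+_; _*_; _∸_; _<_; _<?_; _≤?_; _≤ᵇ_; _⊓_; pred; s≤s; z≤n)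
open import Data.Nat.Combinatorics using (_C_; nCk+nC[k+1]≡[n+1]C[k+1]; nC1≡n)
open import Data.Nat.ListAction using (sum)
open import Data.Nat.ListAction.Properties using (sum-++)
import Data.Nat.Properties as ℕ
open import Data.Product using (∃; _,_; proj₁; proj₂; uncurry)
open import Data.Sum using (_⊎_; inj₁; inj₂; [_,_]′)
open import Data.Vec as Vec using (Vec; []; _∷_; _[_]%=_; lookup; tabulate)
open import Data.Vec.Functional using (Vector; removeAt)
open import Data.Vec.Properties using (lookup∘tabulate; tabulate-cong)
open import Function using (_∘_; id; Equivalence)
open import Function.Bundles using (mk⇔)
open import Function.Definitions using (StrictlySurjective)
open import Level using (0ℓ)
open import Relation.Binary.Construct.Closure.ReflexiveTransitive using (Star; ε; _◅_; _◅◅_; reverse)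
open import Relation.Binary.Definitions using (tri<; tri≈; tri>)
open import Relation.Binary.PropositionalEquality renaming (sym to ≡-sym)
open import Relation.Nullary using (Dec; yes; no; does; contradiction; ¬?; ¬¬-excluded-middle)
open import Relation.Nullary.Decidable using (True; ⌊_⌋; _×-dec_; _→-dec_; _⊎-dec_; decidable-stable; dec-false; dec-true; from-no; from-yes; fromWitness; toWitness)
open import Relation.Unary using (Decidable; Pred)
open import Algebra.Properties.CommutativeMonoid.Sum ℕ.+-0-commutativeMonoid using (sum-remove; sum-cong-≗; ∑-distrib-+; sum-syntax) renaming (sum to ∑)

-- Cuts of unions of colour classes.

-- A side is a `Subset` rather than a predicate, so that the existence of a cut can be decided by
-- enumeration.
Cut : ∀ {n k} → EdgeColouring n k → Pred (Fin k) 0ℓ → Set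
Cut {n} c P = ∃ λ (f : Subset n) →
  (∃ λ x → lookup f x ≡ true) × (∃ λ y → lookup f y ≡ false) ×
  (∀ x y → P (col c x y) → lookup f x ≡ lookup f y)

cut? : ∀ {n k} (c : EdgeColouring n k) {P} → Decidable P → Dec (Cut c P)
cut? c P? = anySubset? λ f →
  any? (λ x → lookup f x Bool.≟ true) ×-dec any? (λ y → lookup f y Bool.≟ false) ×-dec
  all? λ x → all? λ y → P? (col c x y) →-dec (lookup f x Bool.≟ lookup f y)

-- Reachability `Star Adj x` comes with no decision procedure. On a finite set one may be assumed
-- whenever the goal is a negation.
¬¬-decidable : ∀ {n} (P : Pred (Fin n) 0ℓ) → ¬ ¬ Decidable P
¬¬-decidable {zero}  P ¬P? = ¬P? λ ()
¬¬-decidable {suc n} P ¬P? = ¬¬-excluded-middle λ P₀? → ¬¬-decidable (P ∘ suc) λ P? →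
  ¬P? λ { zero → P₀? ; (suc i) → P? i }

module _ {n k} (c : EdgeColouring n k) (gallai : IsGallai c) {P : Pred (Fin k) 0ℓ} where

  private
    Adj : Fin n → Fin n → Set
    Adj x y = P (col c x y)

    adj-sym : ∀ {x y} → Adj x y → Adj y x
    adj-sym {x} {y} = subst P (sym c x y)

  -- For a `P`-edge u u′ of the component, neither v u nor v u′ has a colour in `P`, so both differ
  -- from the colour of u u′. The Gallai condition on v, u, u′ then makes them equal, and this
  -- propagates along the walk.
  uniform : ∀ b {u v w} → ¬ Star Adj u v → col c v u ≡ b → Star Adj u w → col c v w ≡ b
  uniform b                 u↛v vu ε                   = vu
  uniform b {u} {v} {w} u↛v vu (_◅_ {j = u′} uu′ u′w) = uniform b (u↛v ∘ (uu′ ◅_)) vu′ u′w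
    where
    vu′ : col c v u′ ≡ b
    vu′ with col c v u′ ≟ b | u ≟ u′
    ... | yes p | _        = p
    -- `Adj` may hold on the diagonal, so a step of the walk can be a loop.
    ... | no _  | yes refl = vu
    ... | no p  | no u≢u′  = contradiction
      ( (λ q → u↛v (adj-sym (subst P (≡-sym q) uu′) ◅ ε))
      , (λ q → u↛v (uu′ ◅ adj-sym (subst P q uu′) ◅ ε))
      , (λ q → p (trans (≡-sym q) vu)) )
      (gallai v u u′ (λ { refl → u↛v ε }) u≢u′ λ { refl → u↛v (uu′ ◅ ε) })

  -- If the union had no cut, an edge of colour b would leave the P-component of x.
  -- Its outer end v sees the whole component in colour b, so x – v – y keeps
  -- P-adjacent x and y on the same side of every b-cut.
  cut-∪ : Decidable P → ∀ b → Cut c P → Cut c (_≡ b) → Cut c (λ a → P a ⊎ a ≡ b)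
  cut-∪ P? b (f , (x₁ , fx₁) , (y₁ , fy₁) , f-closed) (g , gt , gf , g-closed)
    with cut? c {λ a → P a ⊎ a ≡ b} (λ a → P? a ⊎-dec (a ≟ b))
  ... | yes cut = cut
  -- The cut `g` of colour `b` serves for the union. Boolean equality is stable, so that `P`-edges
  -- respect `g` may be shown by contradiction; this is what makes `¬¬-decidable` applicable.
  ... | no ¬cut = g , gt , gf , λ x y →
    [ (λ xy → decidable-stable (lookup g x Bool.≟ lookup g y) (absurd x y xy)) , g-closed x y ]′
    where
    -- `f` is constant on `P`-components, so each component misses some vertex and can be one side
    -- of a cut.
    f-const : ∀ {x y} → Star Adj x y → lookup f x ≡ lookup f y
    f-const ε          = refl
    f-const (xy ◅ yz) = trans (f-closed _ _ xy) (f-const yz)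

    escape : ∀ x → ∃ λ z → lookup f x ≢ lookup f z
    escape x with lookup f x
    ... | true  = y₁ , λ p → contradiction (trans p fy₁) λ ()
    ... | false = x₁ , λ p → contradiction (trans p fx₁) λ ()

    module _ {x y} (xy : Adj x y) (gx≢gy : lookup g x ≢ lookup g y) (D : Decidable (Star Adj x)) where

      h : Subset n
      h = tabulate (does ∘ D)

      inside : ∀ {u} → Star Adj x u → lookup h u ≡ true
      inside {u} xu = trans (lookup∘tabulate (does ∘ D) u) (dec-true (D u) xu)

      outside : ∀ {u} → ¬ Star Adj x u → lookup h u ≡ false
      outside {u} xu = trans (lookup∘tabulate (does ∘ D) u) (dec-false (D u) xu)

      leaving : ∀ {u v} → Star Adj x u → ¬ Star Adj x v → col c u v ≢ b
      leaving {u} {v} xu ¬xv uv = gx≢gy (trans (≡-sym (g-closed v x (to ux))) (g-closed v y (to (ux ◅◅ xy ◅ ε))))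
        where
        ux : Star Adj u x
        ux = reverse adj-sym xu
        to : ∀ {w} → Star Adj u w → col c v w ≡ b
        to = uniform b (¬xv ∘ (xu ◅◅_)) (trans (sym c v u) uv)

      h-closed : ∀ u v → Adj u v ⊎ col c u v ≡ b → lookup h u ≡ lookup h v
      h-closed u v uv with D u | D v
      ... | yes xu | yes xv = trans (inside xu) (≡-sym (inside xv))
      ... | no xu  | no xv  = trans (outside xu) (≡-sym (outside xv))
      ... | yes xu | no xv  = contradiction uv [ (λ a → xv (xu ◅◅ a ◅ ε)) , leaving xu xv ]′
      ... | no xu  | yes xv = contradiction uv
        [ (λ a → xu (xv ◅◅ adj-sym a ◅ ε)) , leaving xv xu ∘ trans (sym c v u) ]′

      component-cut : Cut c (λ a → P a ⊎ a ≡ b)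
      component-cut = h , (x , inside ε) , (proj₁ (escape x) , outside (proj₂ (escape x) ∘ f-const)) , h-closed

    absurd : ∀ x y → Adj x y → ¬ lookup g x ≢ lookup g y
    absurd x y xy gx≢gy = ¬¬-decidable (Star Adj x) (¬cut ∘ component-cut xy gx≢gy)

cut-⋃ : ∀ {n k} (c : EdgeColouring (2 + n) k) → IsGallai c → (as : List (Fin k)) →
        (∀ {a} → a ∈ as → Cut c (_≡ a)) → Cut c (_∈ as)
-- With no colours every bipartition is a cut; two vertices make both sides nonempty.
cut-⋃ c gallai []       cuts = true ∷ Vec.replicate _ false , (zero , refl) , (suc zero , refl) , λ _ _ ()
cut-⋃ c gallai (a ∷ as) cuts
  with f , t , u , closed ← cut-∪ c gallai (λ b → DecMembership._∈?_ _≟_ b as) a (cut-⋃ c gallai as (cuts ∘ there)) (cuts (here refl))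
  = f , t , u , λ x y → closed x y ∘ λ { (here p) → inj₂ p ; (there p) → inj₁ p }

-- Graphs with too few edges are disconnected.

merge : ∀ {n} (i j : Fin (2 + n)) → ∃ λ (h : Fin (2 + n) → Fin (1 + n)) → StrictlySurjective _≡_ h × h i ≡ h j
merge {n} i j with i ≟ j
-- Even when nothing needs identifying, two labels are pinched, so that each edge costs exactly one
-- class.
... | yes i≡j = pinch zero , (λ z → let x , p = Fin.pinch-surjective zero z in x , p refl) , cong (pinch zero) i≡j
... | no  i≢j = h , (λ z → punchIn i z , h-punchIn z) , trans h-i (≡-sym (h-≢ i≢j))
  where
  h : Fin (2 + n) → Fin (1 + n)
  h k with i ≟ k
  ... | yes _  = punchOut i≢j
  ... | no i≢k = punchOut i≢k
  h-i : h i ≡ punchOut i≢j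
  h-i with i ≟ i
  ... | yes _  = refl
  ... | no i≢i = contradiction refl i≢i
  h-≢ : ∀ {k} (i≢k : i ≢ k) → h k ≡ punchOut i≢k
  h-≢ {k} i≢k with i ≟ k
  ... | yes i≡k = contradiction i≡k i≢k
  ... | no _    = Fin.punchOut-cong i refl
  h-punchIn : ∀ z → h (punchIn i z) ≡ z
  h-punchIn z = trans (h-≢ (Fin.punchInᵢ≢i i z ∘ ≡-sym)) (Fin.punchOut-punchIn i)

-- p labels the classes merged so far; every edge costs at most one class.
quotient : ∀ {n m} (es : List (Fin n × Fin n)) (p : Fin n → Fin (2 + (length es + m))) → StrictlySurjective _≡_ p →
           ∃ λ (q : Fin n → Fin (2 + m)) → StrictlySurjective _≡_ q × (∀ {x y} → p x ≡ p y → q x ≡ q y) ×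
           All (λ (x , y) → q x ≡ q y) es
quotient []             p p-surj = p , p-surj , id , []
quotient ((x , y) ∷ es) p p-surj
  with h , h-surj , hx≡hy ← merge (p x) (p y)
  with q , q-surj , q-resp , q-es ← quotient es (h ∘ p)
    (λ z → let w , hw≡z = h-surj z ; v , pv≡w = p-surj w in v , trans (cong h pv≡w) hw≡z)
  = q , q-surj , q-resp ∘ cong h , q-resp hx≡hy ∷ q-es

-- Merging n singleton classes along fewer than n - 1 edges leaves at least two classes; `f`
-- separates class `zero` from the others.
few-edges-cut : ∀ {n} (es : List (Fin n × Fin n)) → suc (length es) < n →
                ∃ λ (f : Subset n) → (∃ λ x → lookup f x ≡ true) × (∃ λ y → lookup f y ≡ false) ×
                All (λ (x , y) → lookup f x ≡ lookup f y) es
few-edges-cut es lt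
  with m , eq ← ℕ.m≤n⇒∃[o]m+o≡n lt
  with q , q-surj , _ , q-es ← quotient es (Fin.cast (≡-sym eq)) (λ z → Fin.cast eq z , Fin.cast-involutive (≡-sym eq) eq z)
  = tabulate f , witness zero , witness (suc zero)
  , All.map (λ p → trans (lookup∘tabulate f _) (trans (cong g p) (≡-sym (lookup∘tabulate f _)))) q-es
  where
  g : Fin (2 + m) → Bool
  g z = does (z ≟ zero)
  f : Fin _ → Bool
  f = g ∘ q
  witness : ∀ z → ∃ λ x → lookup (tabulate f) x ≡ g z
  witness z = let x , qx≡z = q-surj z in x , trans (lookup∘tabulate f x) (cong g qx≡z)

-- Sparse colour classes and the spanning colour.

isEdge : ∀ {n k} → EdgeColouring n k → Fin k → Fin n → Fin n → Bool
isEdge c a i j = ⌊ toℕ i <? toℕ j ⌋ ∧ ⌊ col c i j ≟ a ⌋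

𝟙 : Bool → ℕ
𝟙 b = if b then 1 else 0

edgeList : ∀ {n k} → EdgeColouring n k → Fin k → List (Fin n × Fin n)
edgeList {n} c a = filter (λ (i , j) → T? (isEdge c a i j)) (cartesianProduct (allFin n) (allFin n))

concatMap-map : ∀ {A B C : Set} (f : A → B → C) xs ys →
                concatMap (λ x → map (f x) ys) xs ≡ map (uncurry f) (cartesianProduct xs ys)
concatMap-map f []       ys = refl
concatMap-map f (x ∷ xs) ys = trans (cong₂ _++_ (map-∘ ys) (concatMap-map f xs ys))
  (≡-sym (map-++ (uncurry f) (map (x ,_) ys) _))

length-filter-T? : ∀ {A : Set} (f : A → Bool) xs → length (filter (T? ∘ f) xs) ≡ sum (map (𝟙 ∘ f) xs)
length-filter-T? f []       = refl
length-filter-T? f (x ∷ xs) with f x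
... | true  = cong suc (length-filter-T? f xs)
... | false = length-filter-T? f xs

length-edgeList : ∀ {n k} (c : EdgeColouring n k) a → length (edgeList c a) ≡ colourCount c a
length-edgeList {n} c a = trans (length-filter-T? _ (cartesianProduct (allFin n) (allFin n)))
  (cong sum (≡-sym (concatMap-map _ (allFin n) (allFin n))))

∈-edgeList : ∀ {n k} (c : EdgeColouring n k) {a x y} → toℕ x < toℕ y → col c x y ≡ a → (x , y) ∈ edgeList c a
∈-edgeList c {a} {x} {y} x<y xy≡a = ∈-filter⁺ (λ (i , j) → T? (isEdge c a i j))
  (∈-cartesianProduct⁺ (∈-allFin x) (∈-allFin y))
  (Equivalence.from T-∧ (fromWitness {a? = toℕ x <? toℕ y} x<y , fromWitness {a? = col c x y ≟ a} xy≡a))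

sparse-cut : ∀ {n k} (c : EdgeColouring n k) a → suc (colourCount c a) < n → Cut c (_≡ a)
sparse-cut {n} c a lt = cut (few-edges-cut (edgeList c a) (subst (λ l → suc l < n) (≡-sym (length-edgeList c a)) lt))
  where
  Respects : Subset n → Fin n × Fin n → Set
  Respects f (x , y) = lookup f x ≡ lookup f y

  closed : ∀ {f} → All (Respects f) (edgeList c a) → ∀ x y → col c x y ≡ a → lookup f x ≡ lookup f y
  closed {f} es x y xy≡a with ℕ.<-cmp (toℕ x) (toℕ y)
  ... | tri< x<y _ _ = All.lookup es (∈-edgeList c x<y xy≡a)
  ... | tri≈ _ x≡y _ = cong (lookup f) (Fin.toℕ-injective x≡y)
  ... | tri> _ _ y<x = ≡-sym (All.lookup es (∈-edgeList c y<x (trans (sym c y x) xy≡a)))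

  cut : (∃ λ f → (∃ λ x → lookup f x ≡ true) × (∃ λ y → lookup f y ≡ false) × All (Respects f) (edgeList c a)) →
        Cut c (_≡ a)
  cut (f , t , u , es) = f , t , u , closed {f} es

-- Otherwise every class is too sparse to be connected, so the union of all classes has a cut,
-- although every pair of vertices has some colour.
some-colour-spans : ∀ {n k} (c : EdgeColouring (2 + n) k) → IsGallai c → ¬ (∀ a → colourCount c a ≤ n)
some-colour-spans {n} {k} c gallai small =
  no-cut (cut-⋃ c gallai (allFin k) (λ {a} _ → sparse-cut c a (s≤s (s≤s (small a)))))
  where
  no-cut : ¬ Cut c (_∈ allFin k)
  no-cut (f , (x , fx) , (y , fy) , closed) =
    contradiction (trans (≡-sym fx) (trans (closed x y (∈-allFin (col c x y))) fy)) λ ()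

-- Colour counts as double sums.

sum-concatMap : ∀ {A : Set} (f : A → List ℕ) xs → sum (concatMap f xs) ≡ sum (map (sum ∘ f) xs)
sum-concatMap f []       = refl
sum-concatMap f (x ∷ xs) = trans (sum-++ (f x) _) (cong (sum (f x) +_) (sum-concatMap f xs))

sum-map-allFin : ∀ {n} (f : Fin n → ℕ) → sum (map f (allFin n)) ≡ ∑ f
sum-map-allFin {n} f = trans (cong sum (map-tabulate id f)) (sum-tabulate f)
  where
  sum-tabulate : ∀ {n} (f : Fin n → ℕ) → sum (List.tabulate f) ≡ ∑ f
  sum-tabulate {zero}  f = refl
  sum-tabulate {suc n} f = cong (f zero +_) (sum-tabulate (f ∘ suc))

colourCount≡∑ : ∀ {n k} (c : EdgeColouring n k) a → colourCount c a ≡ ∑[ i < n ] ∑[ j < n ] 𝟙 (isEdge c a i j)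
colourCount≡∑ {n} c a = trans (sum-concatMap (λ i → map (𝟙 ∘ isEdge c a i) (allFin n)) (allFin n))
  (trans (sum-map-allFin (λ i → sum (map (𝟙 ∘ isEdge c a i) (allFin n)))) (sum-cong-≗ λ i → sum-map-allFin (𝟙 ∘ isEdge c a i)))

∑-mono : ∀ {n} {f g : Fin n → ℕ} → (∀ i → f i ≤ g i) → ∑ f ≤ ∑ g
∑-mono {zero}  f≤g = z≤n
∑-mono {suc n} f≤g = ℕ.+-mono-≤ (f≤g zero) (∑-mono (f≤g ∘ suc))

∑-const : ∀ n x → ∑[ i < n ] x ≡ n * x
∑-const zero    x = refl
∑-const (suc n) x = cong (x +_) (∑-const n x)

∑-↑ : ∀ m {n} (f : Fin (m + n) → ℕ) → ∑ f ≡ ∑[ i < m ] f (i ↑ˡ n) + ∑[ j < n ] f (m ↑ʳ j)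
∑-↑ zero    f = refl
∑-↑ (suc m) f = trans (cong (f zero +_) (∑-↑ m (f ∘ suc))) (≡-sym (ℕ.+-assoc (f zero) _ _))

⌊⌋-cong : ∀ {A B : Set} → (A → B) → (B → A) → (a? : Dec A) (b? : Dec B) → ⌊ a? ⌋ ≡ ⌊ b? ⌋
⌊⌋-cong f g (yes a) (yes b) = refl
⌊⌋-cong f g (yes a) (no ¬b) = contradiction (f a) ¬b
⌊⌋-cong f g (no ¬a) (yes b) = contradiction (g b) ¬a
⌊⌋-cong f g (no ¬a) (no ¬b) = refl

⌊⌋-yes : ∀ {A : Set} → A → (a? : Dec A) → ⌊ a? ⌋ ≡ true
⌊⌋-yes a (yes _) = refl
⌊⌋-yes a (no ¬a) = contradiction a ¬a

⌊⌋-no : ∀ {A : Set} → ¬ A → (a? : Dec A) → ⌊ a? ⌋ ≡ false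
⌊⌋-no ¬a (yes a) = contradiction a ¬a
⌊⌋-no ¬a (no _)  = refl

-- Deleting a vertex.

infixl 20 _∖_

_∖_ : ∀ {n k} → EdgeColouring (suc n) k → Fin (suc n) → EdgeColouring n k
(c ∖ v) .col i j = col c (punchIn v i) (punchIn v j)
(c ∖ v) .sym i j = sym c (punchIn v i) (punchIn v j)

∖-gallai : ∀ {n k} (c : EdgeColouring (suc n) k) v → IsGallai c → IsGallai (c ∖ v)
∖-gallai c v gallai x y z x≢y y≢z x≢z = gallai (punchIn v x) (punchIn v y) (punchIn v z)
  (x≢y ∘ Fin.punchIn-injective v x y) (y≢z ∘ Fin.punchIn-injective v y z) (x≢z ∘ Fin.punchIn-injective v x z)

punchIn-<? : ∀ {n} v (i j : Fin n) → ⌊ toℕ (punchIn v i) <? toℕ (punchIn v j) ⌋ ≡ ⌊ toℕ i <? toℕ j ⌋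
punchIn-<? v i j = ⌊⌋-cong
  (λ p → ℕ.≰⇒> (ℕ.<⇒≱ p ∘ Fin.punchIn-mono-≤ v j i))
  (λ p → ℕ.≰⇒> (ℕ.<⇒≱ p ∘ Fin.punchIn-cancel-≤ v j i)) _ _

isEdge-irrefl : ∀ {n k} (c : EdgeColouring n k) a i → isEdge c a i i ≡ false
isEdge-irrefl c a i rewrite ⌊⌋-no (ℕ.<-irrefl refl) (toℕ i <? toℕ i) = refl

isEdge-either : ∀ {n k} (c : EdgeColouring n k) a {i j} → i ≢ j →
                𝟙 (isEdge c a i j) + 𝟙 (isEdge c a j i) ≡ 𝟙 ⌊ col c i j ≟ a ⌋
isEdge-either c a {i} {j} i≢j rewrite sym c j i with toℕ i <? toℕ j | toℕ j <? toℕ i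
... | yes p | yes q = contradiction q (ℕ.<-asym p)
... | yes _ | no _  = ℕ.+-identityʳ _
... | no _  | yes _ = refl
... | no p  | no q  = contradiction (Fin.toℕ-injective (ℕ.≤-antisym (ℕ.≮⇒≥ q) (ℕ.≮⇒≥ p))) i≢j

-- Row and column `v` are taken out of the double sum. Only increasing pairs are counted, so an edge
-- at `v` contributes to exactly one of the two, while `punchIn v` preserves the order of the
-- remaining pairs.
colourCount-∖ : ∀ {n k} (c : EdgeColouring (suc n) k) v a →
                colourCount c a ≡ ∑[ j < n ] 𝟙 ⌊ col c v (punchIn v j) ≟ a ⌋ + colourCount (c ∖ v) a
colourCount-∖ {n} c v a = begin
  colourCount c a
    ≡⟨ colourCount≡∑ c a ⟩
  ∑[ i < suc n ] ∑ (F i)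
    ≡⟨ sum-remove {i = v} (λ i → ∑ (F i)) ⟩
  ∑ (F v) + ∑[ i < n ] ∑ (F (p i))
    ≡⟨ cong₂ _+_ (sum-remove {i = v} (F v)) (sum-cong-≗ λ i → sum-remove {i = v} (F (p i))) ⟩
  (F v v + ∑[ j < n ] F v (p j)) + ∑[ i < n ] (F (p i) v + ∑[ j < n ] F (p i) (p j))
    ≡⟨ cong₂ (λ x y → x + ∑[ j < n ] F v (p j) + y) (cong 𝟙 (isEdge-irrefl c a v)) (∑-distrib-+ (λ i → F (p i) v) _) ⟩
  ∑[ j < n ] F v (p j) + (∑[ i < n ] F (p i) v + ∑[ i < n ] ∑[ j < n ] F (p i) (p j))
    ≡⟨ ℕ.+-assoc (∑[ j < n ] F v (p j)) _ _ ⟨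
  ∑[ j < n ] F v (p j) + ∑[ i < n ] F (p i) v + ∑[ i < n ] ∑[ j < n ] F (p i) (p j)
    ≡⟨ cong₂ _+_ (≡-sym (∑-distrib-+ (λ j → F v (p j)) _))
                 (sum-cong-≗ λ i → sum-cong-≗ λ j → cong (λ b → 𝟙 (b ∧ ⌊ col c (p i) (p j) ≟ a ⌋)) (punchIn-<? v i j)) ⟩
  ∑[ j < n ] (F v (p j) + F (p j) v) + ∑[ i < n ] ∑[ j < n ] 𝟙 (isEdge (c ∖ v) a i j)
    ≡⟨ cong₂ _+_ (sum-cong-≗ λ j → isEdge-either c a (Fin.punchInᵢ≢i v j ∘ ≡-sym)) (≡-sym (colourCount≡∑ (c ∖ v) a)) ⟩
  ∑[ j < n ] 𝟙 ⌊ col c v (p j) ≟ a ⌋ + colourCount (c ∖ v) a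
    ∎
  where
  open ≡-Reasoning
  F : Fin (suc n) → Fin (suc n) → ℕ
  F i j = 𝟙 (isEdge c a i j)
  p : Fin n → Fin (suc n)
  p = punchIn v

-- Joining two colourings by edges of a single colour.

glueCol : ∀ {m n k} → Fin k → EdgeColouring m k → EdgeColouring n k → Fin m ⊎ Fin n → Fin m ⊎ Fin n → Fin k
glueCol b c d (inj₁ i) (inj₁ j) = col c i j
glueCol b c d (inj₂ i) (inj₂ j) = col d i j
glueCol b c d (inj₁ i) (inj₂ j) = b
glueCol b c d (inj₂ i) (inj₁ j) = b

glue : ∀ {m n k} → Fin k → EdgeColouring m k → EdgeColouring n k → EdgeColouring (m + n) k
glue {m} b c d .col i j = glueCol b c d (splitAt m i) (splitAt m j)
glue {m} b c d .sym i j with splitAt m i | splitAt m j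
... | inj₁ i′ | inj₁ j′ = sym c i′ j′
... | inj₂ i′ | inj₂ j′ = sym d i′ j′
... | inj₁ i′ | inj₂ j′ = refl
... | inj₂ i′ | inj₁ j′ = refl

-- A triangle meeting both parts has two crossing edges, both of colour `b`.
glue-gallai : ∀ {m n k} b (c : EdgeColouring m k) (d : EdgeColouring n k) → IsGallai c → IsGallai d → IsGallai (glue b c d)
glue-gallai {m} b c d gc gd x y z x≢y y≢z x≢z = go (splitAt m x) (splitAt m y) (splitAt m z)
  (x≢y ∘ splitAt-injective) (y≢z ∘ splitAt-injective) (x≢z ∘ splitAt-injective)
  where
  splitAt-injective : ∀ {i j} → splitAt m i ≡ splitAt m j → i ≡ j
  splitAt-injective {i} {j} p = trans (≡-sym (Fin.join-splitAt m _ i)) (trans (cong (Fin.join m _) p) (Fin.join-splitAt m _ j))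
  go : ∀ x y z → x ≢ y → y ≢ z → x ≢ z →
       ¬ (glueCol b c d x y ≢ glueCol b c d y z × glueCol b c d y z ≢ glueCol b c d x z × glueCol b c d x y ≢ glueCol b c d x z)
  go (inj₁ x) (inj₁ y) (inj₁ z) p q r = gc x y z (p ∘ cong inj₁) (q ∘ cong inj₁) (r ∘ cong inj₁)
  go (inj₂ x) (inj₂ y) (inj₂ z) p q r = gd x y z (p ∘ cong inj₂) (q ∘ cong inj₂) (r ∘ cong inj₂)
  go (inj₁ x) (inj₁ y) (inj₂ z) _ _ _ (_ , n , _) = n refl
  go (inj₂ x) (inj₂ y) (inj₁ z) _ _ _ (_ , n , _) = n refl
  go (inj₁ x) (inj₂ y) (inj₁ z) _ _ _ (n , _ , _) = n refl
  go (inj₂ x) (inj₁ y) (inj₂ z) _ _ _ (n , _ , _) = n refl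
  go (inj₁ x) (inj₂ y) (inj₂ z) _ _ _ (_ , _ , n) = n refl
  go (inj₂ x) (inj₁ y) (inj₁ z) _ _ _ (_ , _ , n) = n refl

-- The double sum splits into four blocks. Vertices of the first part precede those of the second,
-- so one mixed block counts all crossing edges and the other is zero.
colourCount-glue : ∀ {m n k} b (c : EdgeColouring m k) (d : EdgeColouring n k) a →
                   colourCount (glue b c d) a ≡ (if ⌊ b ≟ a ⌋ then m * n else 0) + (colourCount c a + colourCount d a)
colourCount-glue {m} {n} b c d a = begin
  colourCount (glue b c d) a
    ≡⟨ colourCount≡∑ (glue b c d) a ⟩
  ∑[ i < m + n ] ∑ (F i)
    ≡⟨ sum-cong-≗ (λ i → ∑-↑ m (F i)) ⟩
  ∑[ i < m + n ] (∑[ j < m ] F i (j ↑ˡ n) + ∑[ j < n ] F i (m ↑ʳ j))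
    ≡⟨ ∑-↑ m _ ⟩
  ∑[ i < m ] (∑[ j < m ] F (i ↑ˡ n) (j ↑ˡ n) + ∑[ j < n ] F (i ↑ˡ n) (m ↑ʳ j)) +
  ∑[ i < n ] (∑[ j < m ] F (m ↑ʳ i) (j ↑ˡ n) + ∑[ j < n ] F (m ↑ʳ i) (m ↑ʳ j))
    ≡⟨ cong₂ _+_ (sum-cong-≗ λ i → cong₂ _+_ (sum-cong-≗ (ll i)) (trans (sum-cong-≗ (lr i)) (∑-const n x)))
                 (sum-cong-≗ λ i → cong₂ _+_ (trans (sum-cong-≗ (rl i)) (trans (∑-const m 0) (ℕ.*-zeroʳ m))) (sum-cong-≗ (rr i))) ⟩
  ∑[ i < m ] (∑[ j < m ] 𝟙 (isEdge c a i j) + n * x) + ∑[ i < n ] ∑[ j < n ] 𝟙 (isEdge d a i j)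
    ≡⟨ cong₂ _+_ (trans (∑-distrib-+ (λ i → ∑[ j < m ] 𝟙 (isEdge c a i j)) (λ _ → n * x)) (cong₂ _+_ (≡-sym (colourCount≡∑ c a)) (∑-const m (n * x))))
                 (≡-sym (colourCount≡∑ d a)) ⟩
  colourCount c a + m * (n * x) + colourCount d a
    ≡⟨ cong (_+ colourCount d a) (ℕ.+-comm (colourCount c a) _) ⟩
  m * (n * x) + colourCount c a + colourCount d a
    ≡⟨ ℕ.+-assoc (m * (n * x)) _ _ ⟩
  m * (n * x) + (colourCount c a + colourCount d a)
    ≡⟨ cong (_+ (colourCount c a + colourCount d a)) (m*n*𝟙 ⌊ b ≟ a ⌋) ⟩
  (if ⌊ b ≟ a ⌋ then m * n else 0) + (colourCount c a + colourCount d a)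
    ∎
  where
  open ≡-Reasoning
  x = 𝟙 ⌊ b ≟ a ⌋
  F : Fin (m + n) → Fin (m + n) → ℕ
  F i j = 𝟙 (isEdge (glue b c d) a i j)
  ll : ∀ i j → F (i ↑ˡ n) (j ↑ˡ n) ≡ 𝟙 (isEdge c a i j)
  ll i j rewrite Fin.splitAt-↑ˡ m i n | Fin.splitAt-↑ˡ m j n | Fin.toℕ-↑ˡ i n | Fin.toℕ-↑ˡ j n = refl
  lr : ∀ i j → F (i ↑ˡ n) (m ↑ʳ j) ≡ x
  lr i j rewrite Fin.splitAt-↑ˡ m i n | Fin.splitAt-↑ʳ m n j | Fin.toℕ-↑ˡ i n | Fin.toℕ-↑ʳ m j
    | ⌊⌋-yes (ℕ.<-≤-trans (Fin.toℕ<n i) (ℕ.m≤m+n m (toℕ j))) (toℕ i <? m + toℕ j) = refl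
  rl : ∀ i j → F (m ↑ʳ i) (j ↑ˡ n) ≡ 0
  rl i j rewrite Fin.splitAt-↑ˡ m j n | Fin.splitAt-↑ʳ m n i | Fin.toℕ-↑ˡ j n | Fin.toℕ-↑ʳ m i
    | ⌊⌋-no (ℕ.<-asym (ℕ.<-≤-trans (Fin.toℕ<n j) (ℕ.m≤m+n m (toℕ i)))) (m + toℕ i <? toℕ j) = refl
  rr : ∀ i j → F (m ↑ʳ i) (m ↑ʳ j) ≡ 𝟙 (isEdge d a i j)
  rr i j rewrite Fin.splitAt-↑ʳ m n i | Fin.splitAt-↑ʳ m n j | Fin.toℕ-↑ʳ m i | Fin.toℕ-↑ʳ m j
    = cong (λ y → 𝟙 (y ∧ ⌊ col d i j ≟ a ⌋))
        (⌊⌋-cong (ℕ.+-cancelˡ-< m _ _) (ℕ.+-monoʳ-< m) (m + toℕ i <? m + toℕ j) (toℕ i <? toℕ j))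
  m*n*𝟙 : ∀ y → m * (n * 𝟙 y) ≡ (if y then m * n else 0)
  m*n*𝟙 true  = cong (m *_) (ℕ.*-identityʳ n)
  m*n*𝟙 false = trans (cong (m *_) (ℕ.*-zeroʳ n)) (ℕ.*-zeroʳ m)

-- Sequences that are not realisable.

not-GSeq : ∀ {n k} {e : Vector ℕ k} → (∀ a → e a ≤ n) → ¬ IsGSeq (2 + n) k e
not-GSeq e≤n (c , gallai , count) = some-colour-spans c gallai λ a → subst (_≤ _) (≡-sym (count a)) (e≤n a)

cutSize : ∀ {n} → Subset n → ℕ
cutSize {n} f = ∑[ i < n ] ∑[ j < n ] 𝟙 (⌊ toℕ i <? toℕ j ⌋ ∧ (lookup f i xor lookup f j))

-- By hypothesis a pair on opposite sides has colour `a`, so the sums compare term by term.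
cutSize≤colourCount : ∀ {n k} (c : EdgeColouring n k) a (f : Subset n) →
                      (∀ i j → col c i j ≢ a → lookup f i ≡ lookup f j) → cutSize f ≤ colourCount c a
cutSize≤colourCount c a f across = subst (cutSize f ≤_) (≡-sym (colourCount≡∑ c a))
  (∑-mono λ i → ∑-mono λ j → bound i j)
  where
  bound : ∀ i j → 𝟙 (⌊ toℕ i <? toℕ j ⌋ ∧ (lookup f i xor lookup f j)) ≤ 𝟙 (isEdge c a i j)
  bound i j with toℕ i <? toℕ j | col c i j ≟ a
  ... | no _  | _     = z≤n
  ... | yes _ | yes _ = 𝟙≤1 (lookup f i xor lookup f j)
    where
    𝟙≤1 : ∀ b → 𝟙 b ≤ 1
    𝟙≤1 true  = s≤s z≤n
    𝟙≤1 false = z≤n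
  ... | yes _ | no p rewrite across i j p | Bool.xor-same (lookup f j) = z≤n

-- The conclusion makes `v` alone one side of the bipartition. With the hypotheses inside, the
-- statement is decidable for each of the 512 subsets.
SmallCutIsolates : Subset 9 → Set
SmallCutIsolates f = cutSize f ≤ 12 → (∃ λ x → lookup f x ≡ true) → (∃ λ y → lookup f y ≡ false) →
                     ∃ λ v → ∀ j → lookup f v ≢ lookup f (punchIn v j)

smallCutIsolates? : ∀ f → Dec (SmallCutIsolates f)
smallCutIsolates? f = (cutSize f ≤? 12) →-dec any? (λ x → lookup f x Bool.≟ true) →-dec
  any? (λ y → lookup f y Bool.≟ false) →-dec
  any? λ v → all? λ j → ¬? (lookup f v Bool.≟ lookup f (punchIn v j))

-- Sides of sizes a and 9 − a are joined by a (9 − a) edges, at least 14 unless a ∈ {1, 8}.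
small-cut-isolates : ∀ f → SmallCutIsolates f
small-cut-isolates f = decidable-stable (smallCutIsolates? f) λ p → from-no (anySubset? (¬? ∘ smallCutIsolates?)) (f , p)

¬GSeq-12-6 : ¬ IsGSeq 9 5 seq12-6
¬GSeq-12-6 (c , gallai , count) = no-cut (cut-⋃ c gallai (map suc (allFin 4)) cut)
  where
  cut : ∀ {a} → a ∈ map suc (allFin 4) → Cut c (_≡ a)
  cut a∈ with b , _ , refl ← ∈-map⁻ suc a∈ =
    -- A connected class on nine vertices needs 8 edges; these have 6.
    sparse-cut c (suc b) (subst (λ e → suc e < 9) (≡-sym (count (suc b))) (from-yes (7 <? 9)))

  no-star : ∀ v → ¬ (∀ j → col c v (punchIn v j) ≡ zero)
  no-star v star = some-colour-spans (c ∖ v) (∖-gallai c v gallai) small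
    where
    split : ∀ a → seq12-6 a ≡ ∑[ j < 8 ] 𝟙 ⌊ col c v (punchIn v j) ≟ a ⌋ + colourCount (c ∖ v) a
    split a = trans (≡-sym (count a)) (colourCount-∖ c v a)
    small : ∀ a → colourCount (c ∖ v) a ≤ 6
    -- The star takes 8 of the 12 edges and leaves 4. The bound 6 is one below the 7 edges needed to
    -- span eight vertices.
    small zero    = ℕ.≤-trans (ℕ.≤-reflexive (≡-sym (ℕ.+-cancelˡ-≡ 8 4 _ (trans (split zero)
      (cong (_+ colourCount (c ∖ v) zero) (sum-cong-≗ λ j → cong 𝟙 (⌊⌋-yes (star j) (col c v (punchIn v j) ≟ zero)))))))) (from-yes (4 ≤? 6))
    small (suc a) = subst (colourCount (c ∖ v) (suc a) ≤_) (≡-sym (split (suc a)))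
      (ℕ.m≤n+m _ (∑[ j < 8 ] 𝟙 ⌊ col c v (punchIn v j) ≟ suc a ⌋))

  no-cut : ¬ Cut c (_∈ map suc (allFin 4))
  no-cut (f , t , u , closed) = isolated (small-cut-isolates f small t u)
    where
    across : ∀ i j → col c i j ≢ zero → lookup f i ≡ lookup f j
    across i j p = closed i j (∈-suc (col c i j) p)
      where
      ∈-suc : ∀ a → a ≢ zero → a ∈ map suc (allFin 4)
      ∈-suc zero    p = contradiction refl p
      ∈-suc (suc a) p = ∈-map⁺ suc (∈-allFin a)
    small : cutSize f ≤ 12
    small = subst (cutSize f ≤_) (count zero) (cutSize≤colourCount c zero f across)
    isolated : ¬ ∃ λ v → ∀ j → lookup f v ≢ lookup f (punchIn v j)
    -- Every other vertex lies opposite `v`, and only colour `zero` crosses, so `v` is the centre of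
    -- a monochromatic star.
    isolated (v , iso) = no-star v λ j → decidable-stable (col c v (punchIn v j) ≟ zero) (iso j ∘ across v (punchIn v j))

-- Operations on G-sequences.

GSeq-resp : ∀ {n k} {e e′ : Vector ℕ k} → e ≗ e′ → IsGSeq n k e → IsGSeq n k e′
GSeq-resp e≗e′ (c , gallai , count) = c , gallai , λ a → trans (count a) (e≗e′ a)

GSeq-one : ∀ {k} → IsGSeq 1 (suc k) λ _ → 0
GSeq-one = record { col = λ _ _ → zero ; sym = λ _ _ → refl } , (λ { zero zero zero p _ _ _ → p refl }) , λ _ → refl

GSeq-glue : ∀ {m n k} {e f : Vector ℕ k} b → IsGSeq m k e → IsGSeq n k f →
            IsGSeq (m + n) k λ a → (if ⌊ b ≟ a ⌋ then m * n else 0) + (e a + f a)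
GSeq-glue {m} {n} b (c , gc , countc) (d , gd , countd) = glue b c d , glue-gallai b c d gc gd ,
  λ a → trans (colourCount-glue b c d a) (cong ((if ⌊ b ≟ a ⌋ then m * n else 0) +_) (cong₂ _+_ (countc a) (countd a)))

-- Renaming colours by `π` turns the old class of the preimage of `a` into the new class of `a`.
-- This reduces realisability to sorted sequences.
GSeq-permute : ∀ {n k} {e : Vector ℕ k} (π : Permutation′ k) → IsGSeq n k (λ a → e (π ⟨$⟩ʳ a)) → IsGSeq n k e
GSeq-permute {n} {k} {e} π (c , gallai , count) = recoloured , gallai′ , count′
  where
  recoloured : EdgeColouring n k
  recoloured .col i j = π ⟨$⟩ʳ col c i j
  recoloured .sym i j = cong (π ⟨$⟩ʳ_) (sym c i j)
  gallai′ : IsGallai recoloured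
  gallai′ x y z p q r (s , t , u) = gallai x y z p q r (s ∘ cong (π ⟨$⟩ʳ_) , t ∘ cong (π ⟨$⟩ʳ_) , u ∘ cong (π ⟨$⟩ʳ_))
  same : ∀ a i j → 𝟙 (isEdge recoloured a i j) ≡ 𝟙 (isEdge c (π ⟨$⟩ˡ a) i j)
  same a i j = cong (λ b → 𝟙 (⌊ toℕ i <? toℕ j ⌋ ∧ b)) (⌊⌋-cong
    (λ p → trans (≡-sym (Perm.inverseˡ π)) (cong (π ⟨$⟩ˡ_) p))
    (λ p → trans (cong (π ⟨$⟩ʳ_) p) (Perm.inverseʳ π)) _ _)
  count′ : ∀ a → colourCount recoloured a ≡ e a
  count′ a = begin
    colourCount recoloured a                             ≡⟨ colourCount≡∑ recoloured a ⟩
    ∑[ i < n ] ∑[ j < n ] 𝟙 (isEdge recoloured a i j)    ≡⟨ sum-cong-≗ (λ i → sum-cong-≗ (same a i)) ⟩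
    ∑[ i < n ] ∑[ j < n ] 𝟙 (isEdge c (π ⟨$⟩ˡ a) i j)    ≡⟨ colourCount≡∑ c (π ⟨$⟩ˡ a) ⟨
    colourCount c (π ⟨$⟩ˡ a)                             ≡⟨ count (π ⟨$⟩ˡ a) ⟩
    e (π ⟨$⟩ʳ (π ⟨$⟩ˡ a))                                ≡⟨ cong e (Perm.inverseʳ π) ⟩
    e a                                                  ∎
    where open ≡-Reasoning

term≤∑ : ∀ {k} (e : Vector ℕ k) i → e i ≤ ∑ e
term≤∑ {suc k} e i = subst (e i ≤_) (≡-sym (sum-remove {i = i} e)) (ℕ.m≤m+n (e i) _)

maximum : ∀ {k} (e : Vector ℕ (suc k)) → ∃ λ i → ∀ j → e j ≤ e i
maximum e = argmax e zero (allFin _) , λ j → All.lookup (f[xs]≤f[argmax] {f = e} zero (allFin _)) (∈-allFin j)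

-- Join trees and the computation on ten vertices.

-- A certificate: the history of joins building a colouring from single vertices. Its counts are
-- found arithmetically, without examining the colouring itself.
data Tree (k : ℕ) : Set where
  leaf : Tree k
  join : Fin k → Tree k → Tree k → Tree k

size : ∀ {k} → Tree k → ℕ
size leaf         = 1
size (join _ s t) = size s + size t

edges : ∀ {k} → Tree k → Fin k → ℕ
edges leaf         a = 0
edges (join b s t) a = (if ⌊ b ≟ a ⌋ then size s * size t else 0) + (edges s a + edges t a)

-- A choice point of a backtracking search in continuation-passing style: `d` edges are charged to a
-- colour that still has them, and the next colour is tried if `f` fails.
place : ∀ {A : Set} {k} → ℕ → Vec ℕ k → (Fin k → Vec ℕ k → Maybe A) → Maybe A
place {k = k} d v f = go (allFin k)
  where
  go : List (Fin k) → Maybe _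
  go []       = nothing
  go (a ∷ as) = (if d ≤ᵇ lookup v a then f a (v [ a ]%= (_∸ d)) else nothing) <∣> go as

pair : ∀ {k} → Fin k → Tree k
pair a = join a leaf leaf

-- search n looks for a tree with n + 1 leaves; peelᵢ splits off i of them. The
-- result is uncertified: Realised recomputes the size and the counts of the tree.
-- Pieces of four vertices are needed only for (30,4,4,4,3), (29,4,4,4,4),
-- (26,5,5,5,4), (25,5,5,5,5) and (20,13,4,4,4).
search : ℕ → Vec ℕ 5 → Maybe (Tree 5)
search zero    v = just leaf
search (suc n) v = peel₁ n <∣> peel₂ n <∣> peel₃ n <∣> peel₄ n
  where
  peel₁ peel₂ peel₃ peel₄ : ℕ → Maybe (Tree 5)
  peel₁ n = place (1 + n) v λ a w → Maybe.map (join a leaf) (search n w)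
  peel₂ (suc n) = place (2 * (1 + n)) v λ a w → place 1 w λ b x →
    Maybe.map (join a (pair b)) (search n x)
  peel₂ _ = nothing
  peel₃ (suc (suc n)) = place (3 * (1 + n)) v λ a w → place 2 w λ b x → place 1 x λ c y →
    Maybe.map (join a (join b leaf (pair c))) (search n y)
  peel₃ _ = nothing
  peel₄ (suc (suc (suc n))) = place (4 * (1 + n)) v λ a w → place 4 w λ b x → place 1 x λ c y → place 1 y λ d z →
    Maybe.map (join a (join b (pair c) (pair d))) (search n z)
  peel₄ _ = nothing

-- `m` bounds the next entry and `s` is the sum still to be distributed; each chosen entry becomes
-- the bound for the rest.
nonincreasing : ∀ k → ℕ → ℕ → List (Vec ℕ k)
nonincreasing zero    m zero    = [] ∷ []
nonincreasing zero    m (suc s) = []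
nonincreasing (suc k) m s = concatMap (λ a → map (a ∷_) (nonincreasing k a (s ∸ a))) (upTo (suc (m ⊓ s)))

Realised : ℕ → Vec ℕ 5 → Set
Realised n v = MAny.Any (λ t → size t ≡ n × (∀ a → edges t a ≡ lookup v a)) (search (pred n) v)

realised? : ∀ n v → Dec (Realised n v)
realised? n v = MAny.dec (λ t → size t ℕ.≟ n ×-dec all? (λ a → edges t a ℕ.≟ lookup v a)) (search (pred n) v)


-- Selection sort: a maximal entry goes first and bounds the others, and the permutation sorting
-- those is extended by `Perm.insert`.
nonincreasing-complete : ∀ {k} m (e : Vector ℕ k) → (∀ i → e i ≤ m) →
                 ∃ λ (π : Permutation′ k) → tabulate (λ a → e (π ⟨$⟩ʳ a)) ∈ nonincreasing k m (∑ e)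
nonincreasing-complete {zero}  m e e≤m = Perm.id , here refl
nonincreasing-complete {suc k} m e e≤m = Perm.insert zero i π ,
  ∈-concatMap⁺ (λ a → map (a ∷_) (nonincreasing k a (∑ e ∸ a)))
    (Any.map (λ { refl → ∈-map⁺ (e i ∷_) (subst₂ _∈_ rest (cong (nonincreasing k (e i)) sum-rest) π∈) })
      (∈-upTo⁺ (s≤s (ℕ.⊓-glb (e≤m i) (term≤∑ e i)))))
  where
  max = maximum e
  i   = proj₁ max
  IH  = nonincreasing-complete (e i) (removeAt e i) (proj₂ max ∘ punchIn i)
  π   = proj₁ IH
  π∈  = proj₂ IH
  sum-rest : ∑ (removeAt e i) ≡ ∑ e ∸ e i
  sum-rest = ≡-sym (trans (cong (_∸ e i) (sum-remove {i = i} e)) (ℕ.m+n∸m≡n (e i) _))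
  rest : tabulate (λ a → e (punchIn i (π ⟨$⟩ʳ a))) ≡ tabulate (λ a → e (Perm.insert zero i π ⟨$⟩ʳ suc a))
  rest = tabulate-cong λ a → cong e (≡-sym (Perm.insert-punchIn zero i π a))

tree-GSeq : ∀ {k} (t : Tree (suc k)) → IsGSeq (size t) (suc k) (edges t)
tree-GSeq leaf         = GSeq-one
tree-GSeq (join b s t) = GSeq-glue b (tree-GSeq s) (tree-GSeq t)

realised-GSeq : ∀ {n v} → Realised n v → IsGSeq n 5 (lookup v)
realised-GSeq {n} {v} r with t , refl , count ← MAny.satisfied r = GSeq-resp count (tree-GSeq t)

-- The sum `s` doubles as the initial bound, since no entry exceeds the total.
sorted-suffice : ∀ {n k s} → All (IsGSeq n k ∘ lookup) (nonincreasing k s s) → (e : Vector ℕ k) → ∑ e ≡ s → IsGSeq n k e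
sorted-suffice {k = k} {s} all e ∑e≡s =
  GSeq-permute π (GSeq-resp (lookup∘tabulate (λ a → e (π ⟨$⟩ʳ a))) (All.lookup all v∈))
  where
  sorted = nonincreasing-complete s e λ i → subst (e i ≤_) ∑e≡s (term≤∑ e i)
  π = proj₁ sorted
  v∈ : tabulate (λ a → e (π ⟨$⟩ʳ a)) ∈ nonincreasing k s s
  v∈ = subst (λ t → tabulate (λ a → e (π ⟨$⟩ʳ a)) ∈ nonincreasing k s t) ∑e≡s (proj₂ sorted)

nonincreasing-realised : All (Realised 10) (nonincreasing 5 45 45)
-- Here 45 is the number of edges of the complete graph on ten vertices; evaluation runs `search` on
-- every sorted vector.
nonincreasing-realised = toWitness {a? = All.all? (realised? 10) (nonincreasing 5 45 45)} _

AllGSeq-10 : AllGSeq 10 5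
AllGSeq-10 e e-seq = sorted-suffice (All.map (λ {v} → realised-GSeq {10} {v}) nonincreasing-realised) e
  (trans (≡-sym (sum-map-allFin e)) e-seq)

-- Adding a vertex when n ≥ 9.

C2-suc : ∀ n → suc n C 2 ≡ n + n C 2
C2-suc n = trans (≡-sym (nCk+nC[k+1]≡[n+1]C[k+1] n 1)) (cong (_+ n C 2) (nC1≡n n))

-- At n = 9 both sides are 36; each increment of n then adds 4 on the left and n on the right.
4n≤nC2 : ∀ m → 4 * (9 + m) ≤ (9 + m) C 2
4n≤nC2 zero    = ℕ.≤-refl
4n≤nC2 (suc m) = begin
  4 * suc n     ≡⟨ ℕ.*-suc 4 n ⟩
  4 + 4 * n     ≤⟨ ℕ.+-mono-≤ (ℕ.m≤n⇒m≤n+o m (from-yes (4 ≤? 9))) (4n≤nC2 m) ⟩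
  n + n C 2     ≡⟨ C2-suc n ⟨
  suc n C 2     ∎
  where
  open ℕ.≤-Reasoning
  n = 9 + m

∑-indicator : ∀ {k} (i : Fin (suc k)) x → ∑ (λ a → if ⌊ i ≟ a ⌋ then x else 0) ≡ x
∑-indicator {k} i x = begin
  ∑ δ                                 ≡⟨ sum-remove {i = i} δ ⟩
  δ i + ∑[ j < k ] δ (punchIn i j)    ≡⟨ cong₂ _+_ (cong (if_then x else 0) (⌊⌋-yes refl (i ≟ i)))
                                           (sum-cong-≗ λ j → cong (if_then x else 0) (⌊⌋-no (Fin.punchInᵢ≢i i j ∘ ≡-sym) (i ≟ punchIn i j))) ⟩
  x + ∑[ j < k ] 0                    ≡⟨ cong (x +_) (trans (∑-const k 0) (ℕ.*-zeroʳ k)) ⟩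
  x + 0                               ≡⟨ ℕ.+-identityʳ x ⟩
  x                                   ∎
  where
  open ≡-Reasoning
  δ : Fin (suc k) → ℕ
  δ a = if ⌊ i ≟ a ⌋ then x else 0

-- The hypothesis makes the total at least (k + 1) n, so a largest entry is at least n. It pays for
-- a star at the new vertex, and what remains is a sequence on n vertices.
AllGSeq-suc : ∀ {n k} → k * n ≤ n C 2 → AllGSeq n (suc k) → AllGSeq (suc n) (suc k)
AllGSeq-suc {n} {k} kn≤nC2 all e e-seq = GSeq-resp split (GSeq-glue i GSeq-one (all e′ e′-seq))
  where
  i = proj₁ (maximum e)
  ∑e : ∑ e ≡ n + n C 2
  ∑e = trans (≡-sym (sum-map-allFin e)) (trans e-seq (C2-suc n))
  n≤ei : n ≤ e i
  n≤ei = ℕ.*-cancelˡ-≤ (suc k) (begin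
    suc k * n        ≤⟨ ℕ.+-monoʳ-≤ n kn≤nC2 ⟩
    n + n C 2        ≡⟨ ∑e ⟨
    ∑ e              ≤⟨ ∑-mono (proj₂ (maximum e)) ⟩
    ∑[ a < suc k ] e i   ≡⟨ ∑-const (suc k) (e i) ⟩
    suc k * e i          ∎)
    where open ℕ.≤-Reasoning
  star e′ : Vector ℕ (suc k)
  -- Written `1 * n` to agree by computation with the count that `GSeq-glue` gives for a one-vertex
  -- part.
  star a = if ⌊ i ≟ a ⌋ then 1 * n else 0
  e′ a = e a ∸ star a
  split : ∀ a → star a + e′ a ≡ e a
  split a with i ≟ a
  ... | yes refl = ℕ.m+[n∸m]≡n (subst (_≤ e i) (≡-sym (ℕ.*-identityˡ n)) n≤ei)
  ... | no _     = refl
  e′-seq : IsSeq n (suc k) e′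
  e′-seq = trans (sum-map-allFin e′) (ℕ.+-cancelˡ-≡ n _ _ (begin
    n + ∑ e′               ≡⟨ cong (_+ ∑ e′) (trans (∑-indicator i (1 * n)) (ℕ.*-identityˡ n)) ⟨
    ∑ star + ∑ e′          ≡⟨ ∑-distrib-+ star e′ ⟨
    ∑ (λ a → star a + e′ a) ≡⟨ sum-cong-≗ split ⟩
    ∑ e                    ≡⟨ ∑e ⟩
    n + n C 2              ∎))
    where open ≡-Reasoning

AllGSeq-≥10 : ∀ m → AllGSeq (10 + m) 5
AllGSeq-≥10 zero    = AllGSeq-10
-- The step starts from n = 10 + m, which is 9 + `suc m`.
AllGSeq-≥10 (suc m) = AllGSeq-suc (4n≤nC2 (suc m)) (AllGSeq-≥10 m)

-- Small n and the threshold.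

-- The implicit `True` argument is solved by evaluation once the vector is a literal.
¬AllGSeq : ∀ {n} (v : Vec ℕ 5) → IsSeq (2 + n) 5 (lookup v) → {True (all? λ a → lookup v a ≤? n)} → ¬ AllGSeq (2 + n) 5
¬AllGSeq v v-seq {v≤n} all = not-GSeq (toWitness v≤n) (all (lookup v) v-seq)

-- All entries below are at most n − 2, so no colour class can span K_n.
AllGSeq⇒10≤ : ∀ n → 3 ≤ n → AllGSeq n 5 → 10 ≤ n
AllGSeq⇒10≤ 0 ()
AllGSeq⇒10≤ 1 (s≤s ())
AllGSeq⇒10≤ 2 (s≤s (s≤s ()))
AllGSeq⇒10≤ 3 _ all = contradiction all (¬AllGSeq (1 ∷ 1 ∷ 1 ∷ 0 ∷ 0 ∷ []) refl)
AllGSeq⇒10≤ 4 _ all = contradiction all (¬AllGSeq (2 ∷ 1 ∷ 1 ∷ 1 ∷ 1 ∷ []) refl)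
AllGSeq⇒10≤ 5 _ all = contradiction all (¬AllGSeq (2 ∷ 2 ∷ 2 ∷ 2 ∷ 2 ∷ []) refl)
AllGSeq⇒10≤ 6 _ all = contradiction all (¬AllGSeq (3 ∷ 3 ∷ 3 ∷ 3 ∷ 3 ∷ []) refl)
AllGSeq⇒10≤ 7 _ all = contradiction all (¬AllGSeq (5 ∷ 4 ∷ 4 ∷ 4 ∷ 4 ∷ []) refl)
AllGSeq⇒10≤ 8 _ all = contradiction all (¬AllGSeq (6 ∷ 6 ∷ 6 ∷ 5 ∷ 5 ∷ []) refl)
-- Bounding all entries is impossible here: five entries of at most 7 sum to at most 35, while 36
-- edges are required. Hence the separate sequence.
AllGSeq⇒10≤ 9 _ all = contradiction (all seq12-6 refl) ¬GSeq-12-6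
AllGSeq⇒10≤ (suc (suc (suc (suc (suc (suc (suc (suc (suc (suc n)))))))))) _ _ = ℕ.m≤m+n 10 n

theorem1p5 : IsSeq 9 5 seq12-6 × ¬ IsGSeq 9 5 seq12-6
    × AllGSeq 10 5
    × (∀ (n : ℕ) → 3 ≤ n → (AllGSeq n 5 ⇔ 10 ≤ n))
theorem1p5 = refl , ¬GSeq-12-6 , AllGSeq-10 , λ n 3≤n → mk⇔ (AllGSeq⇒10≤ n 3≤n) λ 10≤n →
  subst (λ n → AllGSeq n 5) (ℕ.m+[n∸m]≡n 10≤n) (AllGSeq-≥10 (n ∸ 10))
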